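{- Let $a,b$ be integers with $(a,b)\neq(0,0)$ and suppose $0\in\chi(a,b)$. Let $p$ be an odd prime that is a $0$-PL prime relative to $(a,b)$. Then for every integer $q\geq 1$, the path graph $P_{q\pi_p(a,b)+1}$ is an $(a,b)$-FLC graph modulo $p$.
   Context: For integers $a,b$, the $(a,b)$-Fibonacci sequence is $F_0=a$, $F_1=b$, $F_n=F_{n-1}+F_{n-2}$ for $n\ge 2$. $(x/p)$ denotes the Legendre symbol for an odd prime $p$ (equal to $0$ when $p\mid x$). The $(a,b)$-Pisano period $\pi_p(a,b)$ is the smallest positive integer $t$ such that $F_{n+t}\equiv F_n \pmod p$ for all $n\ge 0$. For an odd prime $p$ and $j\in\{ -1,0,1\}$, let $\Lambda_j^p(a,b)=\{\xi\in\{0,1,\ldots,\pi_p(a,b)-1\} : (F_\xi/p)=j\}$. The prime $p$ is a $k$-PL prime ($k$-Pisano-Legendre prime) relative to $(a,b)$ if $k=|\Lambda_1^p(a,b)|-|\Lambda_{ -1}^p(a,b)|-|\Lambda_0^p(a,b)|$. The Pisano set $\chi(a,b)$ is the set of all integers $k$ for which there exists an odd prime $p$ that is a $k$-PL prime relative to $(a,b)$. Let $G$ be a simple connected graph of order (number of vertices) $n$. A bijection $f:V(G)\to\{0,1,\ldots,n-1\}$ is an $(a,b)$-FLC labeling (Fibonacci-Legendre cordial labeling) modulo $p$ if the induced edge labeling $f_p^*:E(G)\to\{0,1\}$, given by $f_p^*(uv)=\frac{1+([F_{f(u)}+F_{f(v)}]/p)}{2}$ if $F_{f(u)}+F_{f(v)}\not\equiv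 0\pmod p$ and $f_p^*(uv)=0$ otherwise, satisfies $|e_{f_p^*}(0)-e_{f_p^*}(1)|\le 1$, where $e_{f_p^*}(i)$ is the number of edges labeled $i$. A graph admitting such a labeling is an $(a,b)$-FLC graph modulo $p$. The path graph $P_n$ has $n$ vertices $v_1,\ldots,v_n$ and edges $v_iv_{i+1}$ for $1\le i\le n-1$. -}

module Defs where

open import Data.Bool.Base using (if_then_else_)
open import Data.Fin.Base as Fin using (Fin; zero; suc; toℕ; fromℕ<; inject₁; combine)
open import Data.Fin.Induction using (<-weakInduction)
open import Data.Fin.Properties as Fin
  using (any?; pigeonhole; combine-injective; toℕ-inject₁; toℕ-fromℕ<)
open import Data.Fin.Subset using (Subset; ∣_∣)
open import Data.Integer.Base using (ℤ; +_; 0ℤ; 1ℤ; -1ℤ; _+_; _-_; _*_; -_; _/ℕ_; _%ℕ_)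
open import Data.Integer.DivMod using (a≡a%ℕn+[a/ℕn]*n; n%ℕd<d)
open import Data.Integer.Divisibility.Signed
  using (_∣_; divides; _∣?_; ∣m∣n⇒∣m+n; ∣m∣n⇒∣m-n; ∣n⇒∣m*n)
open import Data.Integer.Properties as ℤ using ()
import Data.Integer.Solver as ℤ-Solver
open import Data.List.Base using (List; filter; length; allFin; cartesianProduct)
open import Data.Nat.Base as ℕ using (ℕ; zero; suc; NonZero; s≤s)
open import Data.Nat.Divisibility using (_∤_)
open import Data.Nat.Induction using (<-rec)
open import Data.Nat.Primality using (Prime; prime⇒nonZero)
open import Data.Nat.Properties as ℕ using (anyUpTo?)
open import Data.Product.Base using (∃; ∃-syntax; _×_; _,_; proj₁; proj₂)
open import Data.Sum.Base using (_⊎_; inj₁; inj₂; swap)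
open import Data.Vec.Base using (tabulate)
open import Function.Bundles using (_⤖_; module Bijection)
open import Level using (0ℓ)
open import Relation.Binary.Construct.Closure.ReflexiveTransitive
  using (Star; ε; _◅_; _◅◅_; reverse)
open import Relation.Binary.Core using (Rel)
open import Relation.Binary.Definitions using (Symmetric; Irreflexive; Decidable)
open import Relation.Binary.PropositionalEquality
  using (_≡_; refl; sym; trans; cong; subst)
open import Relation.Nullary.Decidable
  using (Dec; yes; no; does; map′; _×-dec_; _⊎-dec_)
open import Relation.Unary using (Pred)

record OddPrime : Set where
  constructor oddPrime
  field
    value   : ℕ
    isPrime : Prime value
    isOdd   : 2 ∤ value

  instance
    nonZero : NonZero value
    nonZero = prime⇒nonZero isPrime

open OddPrime using (value)

infix 4 _≡_[mod_] _≡?_[mod_]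

_≡_[mod_] : ℤ → ℤ → OddPrime → Set
x ≡ y [mod p ] = + value p ∣ x - y

_≡?_[mod_] : ∀ x y p → Dec (x ≡ y [mod p ])
x ≡? y [mod p ] = + value p ∣? (x - y)

private
  open ℤ-Solver.+-*-Solver

  mod-refl : ∀ p x → x ≡ x [mod p ]
  mod-refl p x = divides 0ℤ (ℤ.+-inverseʳ x)

  mod-sym : ∀ p x y → x ≡ y [mod p ] → y ≡ x [mod p ]
  mod-sym p x y d = subst (+ value p ∣_)
    (solve 2 (λ x y → con -1ℤ :* (x :- y) := y :- x) refl x y) (∣n⇒∣m*n -1ℤ d)

  mod-trans : ∀ p x y z → x ≡ y [mod p ] → y ≡ z [mod p ] → x ≡ z [mod p ]
  mod-trans p x y z d e = subst (+ value p ∣_)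
    (solve 3 (λ x y z → (x :- y) :+ (y :- z) := x :- z) refl x y z) (∣m∣n⇒∣m+n d e)

  mod-+ : ∀ p x x′ y y′ → x ≡ x′ [mod p ] → y ≡ y′ [mod p ] → x + y ≡ x′ + y′ [mod p ]
  mod-+ p x x′ y y′ d e = subst (+ value p ∣_)
    (solve 4 (λ x x′ y y′ → (x :- x′) :+ (y :- y′) := (x :+ y) :- (x′ :+ y′)) refl x x′ y y′)
    (∣m∣n⇒∣m+n d e)

  mod-cancelˡ : ∀ p x x′ y y′ → x + y ≡ x′ + y′ [mod p ] → x ≡ x′ [mod p ] → y ≡ y′ [mod p ]
  mod-cancelˡ p x x′ y y′ d e = subst (+ value p ∣_)
    (solve 4 (λ x x′ y y′ → ((x :+ y) :- (x′ :+ y′)) :- (x :- x′) := y :- y′) refl x x′ y y′)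
    (∣m∣n⇒∣m-n d e)

  module _ (p : OddPrime) where
    open OddPrime p using (nonZero)

    rem : ℤ → Fin (value p)
    rem x = fromℕ< (n%ℕd<d x (value p))

    mod-rem : ∀ x → + toℕ (rem x) ≡ x [mod p ]
    mod-rem x = divides (- q) (trans
      (cong (λ h → + toℕ (rem x) - h) (a≡a%ℕn+[a/ℕn]*n x (value p)))
      (trans (cong (λ h → + h - (r + q * v)) (toℕ-fromℕ< (n%ℕd<d x (value p))))
        (solve 3 (λ r q v → r :- (r :+ q :* v) := (:- q) :* v) refl r q v)))
      where
      v = + value p
      q = x /ℕ value p
      r = + (x %ℕ value p)

    rem-≡⇒mod : ∀ x y → rem x ≡ rem y → x ≡ y [mod p ]
    rem-≡⇒mod x y eq = mod-trans p x r y (mod-sym p r x (mod-rem x))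
      (subst (λ i → + toℕ i ≡ y [mod p ]) (sym eq) (mod-rem y))
      where r = + toℕ (rem x)

  mod-square : ∀ p x y → x ≡ y [mod p ] → x * x ≡ y * y [mod p ]
  mod-square p x y d = subst (+ value p ∣_)
    (solve 2 (λ x y → (x :+ y) :* (x :- y) := x :* x :- y :* y) refl x y)
    (∣n⇒∣m*n (x + y) d)

IsSquareMod : OddPrime → Pred ℤ 0ℓ
IsSquareMod p x = ∃[ y ] y * y ≡ x [mod p ]

isSquareMod? : ∀ p x → Dec (IsSquareMod p x)
isSquareMod? p x = map′
  (λ (r , d) → + toℕ r , d)
  (λ (y , d) → let r = + toℕ (rem p y) in
    rem p y , mod-trans p (r * r) (y * y) x (mod-square p r y (mod-rem p y)) d)
  (any? λ r → + toℕ r * + toℕ r ≡? x [mod p ])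

legendre : OddPrime → ℤ → ℤ
legendre p x =
  if does (+ value p ∣? x) then 0ℤ
  else if does (isSquareMod? p x) then 1ℤ
  else -1ℤ

F : ℤ → ℤ → ℕ → ℤ
F a b zero          = a
F a b (suc zero)    = b
F a b (suc (suc n)) = F a b (suc n) + F a b n

IsPeriod : OddPrime → ℤ → ℤ → Pred ℕ 0ℓ
IsPeriod p a b t = ∀ n → F a b (n ℕ.+ t) ≡ F a b n [mod p ]

record IsPisanoPeriod (p : OddPrime) (a b : ℤ) (t : ℕ) : Set where
  field
    positive : 1 ℕ.≤ t
    isPeriod : IsPeriod p a b t
    minimal  : ∀ s → 1 ℕ.≤ s → IsPeriod p a b s → t ℕ.≤ s

private
  module _ (p : OddPrime) (a b : ℤ) where
    open OddPrime p using (nonZero)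

    AgreeAt : ℕ → ℕ → Set
    AgreeAt m n = F a b m ≡ F a b n [mod p ] × F a b (suc m) ≡ F a b (suc n) [mod p ]

    ascend : ∀ t → AgreeAt t 0 → ∀ n → AgreeAt (n ℕ.+ t) n
    ascend t h zero    = h
    ascend t h (suc n) = let (d , e) = ascend t h n in
      e , mod-+ p (F a b (suc (n ℕ.+ t))) (F a b (suc n)) (F a b (n ℕ.+ t)) (F a b n) e d

    descend : ∀ m n → m ℕ.< n → AgreeAt m n → ∃[ t ] 1 ℕ.≤ t × AgreeAt t 0
    descend zero    n       m<n (d , e) =
      n , m<n , mod-sym p a (F a b n) d , mod-sym p b (F a b (suc n)) e
    descend (suc m) (suc n) (s≤s m<n) (d , e) = descend m n m<n
      ( mod-cancelˡ p (F a b (suc m)) (F a b (suc n)) (F a b m) (F a b n) e d , d)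

    isPeriod? : ∀ t → Dec (IsPeriod p a b t)
    isPeriod? t = map′ (λ h n → proj₁ (ascend t h n)) (λ h → h 0 , h 1)
      ((F a b t ≡? a [mod p ]) ×-dec (F a b (suc t) ≡? b [mod p ]))

    state : ℕ → Fin (value p ℕ.* value p)
    state n = combine (rem p (F a b n)) (rem p (F a b (suc n)))

    positivePeriod : ∃[ t ] 1 ℕ.≤ t × IsPeriod p a b t
    positivePeriod =
      let (i , j , i<j , eq) = pigeonhole (ℕ.n<1+n (value p ℕ.* value p)) (λ i → state (toℕ i))
          (eq₁ , eq₂) = combine-injective
            (rem p (F a b (toℕ i))) (rem p (F a b (suc (toℕ i))))
            (rem p (F a b (toℕ j))) (rem p (F a b (suc (toℕ j)))) eq
          (t , t≥1 , h) = descend (toℕ i) (toℕ j) i<j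
            ( rem-≡⇒mod p (F a b (toℕ i)) (F a b (toℕ j)) eq₁
            , rem-≡⇒mod p (F a b (suc (toℕ i))) (F a b (suc (toℕ j))) eq₂)
      in t , t≥1 , λ n → proj₁ (ascend t h n)

    least : ∀ t → 1 ℕ.≤ t → IsPeriod p a b t → ∃ (IsPisanoPeriod p a b)
    least = <-rec _ step
      where
      step : ∀ t →
             (∀ {s} → s ℕ.< t → 1 ℕ.≤ s → IsPeriod p a b s → ∃ (IsPisanoPeriod p a b)) →
             1 ℕ.≤ t → IsPeriod p a b t → ∃ (IsPisanoPeriod p a b)
      step t rec t≥1 h with anyUpTo? (λ s → (1 ℕ.≤? s) ×-dec isPeriod? s) t
      ... | yes (s , s<t , s≥1 , h′) = rec s<t s≥1 h′
      ... | no  none = t , record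
        { positive = t≥1
        ; isPeriod = h
        ; minimal  = λ s s≥1 h′ → ℕ.≮⇒≥ λ s<t → none (s , s<t , s≥1 , h′)
        }

pisanoPeriod-exists : ∀ p a b → ∃ (IsPisanoPeriod p a b)
pisanoPeriod-exists p a b =
  let (t , t≥1 , h) = positivePeriod p a b in least p a b t t≥1 h

π : OddPrime → ℤ → ℤ → ℕ
π p a b = proj₁ (pisanoPeriod-exists p a b)

π-isPisanoPeriod : ∀ p a b → IsPisanoPeriod p a b (π p a b)
π-isPisanoPeriod p a b = proj₂ (pisanoPeriod-exists p a b)

Λ : ℤ → (p : OddPrime) (a b : ℤ) → Subset (π p a b)
Λ j p a b = tabulate λ ξ → does (legendre p (F a b (toℕ ξ)) ℤ.≟ j)

IsPLPrime : ℤ → OddPrime → ℤ → ℤ → Set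
IsPLPrime k p a b = k ≡ + ∣ Λ 1ℤ p a b ∣ - + ∣ Λ -1ℤ p a b ∣ - + ∣ Λ 0ℤ p a b ∣

χ : ℤ → ℤ → Pred ℤ 0ℓ
χ a b k = ∃[ p ] IsPLPrime k p a b

-- Graphs of order n have vertex set Fin n.
record SimpleConnectedGraph (n : ℕ) : Set₁ where
  infix 4 _~_ _~?_
  field
    _~_         : Rel (Fin n) 0ℓ
    _~?_        : Decidable _~_
    symmetric   : Symmetric _~_
    irreflexive : Irreflexive _≡_ _~_
    connected   : ∀ u v → Star _~_ u v

  -- Each edge is listed once, as the pair of its endpoints in increasing order.
  edges : List (Fin n × Fin n)
  edges = filter (λ (u , v) → (u Fin.<? v) ×-dec (u ~? v))
                 (cartesianProduct (allFin n) (allFin n))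

-- The vertex vᵢ₊₁ of the path is the element of Fin n with value i.
path : ∀ n → SimpleConnectedGraph n
path n = record
  { _~_         = Adjacent
  ; _~?_        = λ u v → (toℕ v ℕ.≟ suc (toℕ u)) ⊎-dec (toℕ u ℕ.≟ suc (toℕ v))
  ; symmetric   = swap
  ; irreflexive = λ { refl (inj₁ e) → ℕ.1+n≢n (sym e) ; refl (inj₂ e) → ℕ.1+n≢n (sym e) }
  ; connected   = connected n
  }
  where
  Adjacent : ∀ {n} → Rel (Fin n) 0ℓ
  Adjacent u v = toℕ v ≡ suc (toℕ u) ⊎ toℕ u ≡ suc (toℕ v)

  connected : ∀ n (u v : Fin n) → Star Adjacent u v
  connected (suc n) u v = reverse swap (fromZero u) ◅◅ fromZero v
    where
    fromZero : ∀ u → Star Adjacent zero u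
    fromZero = <-weakInduction (Star Adjacent zero) ε
      λ i walk → walk ◅◅ (inj₁ (cong suc (sym (toℕ-inject₁ i))) ◅ ε)

-- The quotient is exact and lies in {0, 1}: the symbol is ±1 when p does not
-- divide its argument.
edgeLabel : ∀ {n} → OddPrime → ℤ → ℤ → Fin n ⤖ Fin n → Fin n → Fin n → ℤ
edgeLabel p a b f u v =
  if does (s ≡? 0ℤ [mod p ]) then 0ℤ else (1ℤ + legendre p s) /ℕ 2
  where
  open Bijection f using (to)
  s = F a b (toℕ (to u)) + F a b (toℕ (to v))

edgeCount : ∀ {n} → OddPrime → ℤ → ℤ → SimpleConnectedGraph n → Fin n ⤖ Fin n → ℤ → ℕ
edgeCount p a b G f i =
  length (filter (λ (u , v) → edgeLabel p a b f u v ℤ.≟ i) (SimpleConnectedGraph.edges G))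

IsFLCLabeling : ∀ {n} → OddPrime → ℤ → ℤ → SimpleConnectedGraph n → Fin n ⤖ Fin n → Set
IsFLCLabeling p a b G f =
  ℕ.∣ edgeCount p a b G f 0ℤ - edgeCount p a b G f 1ℤ ∣ ℕ.≤ 1

IsFLCGraph : ∀ {n} → OddPrime → ℤ → ℤ → SimpleConnectedGraph n → Set
IsFLCGraph p a b G = ∃[ f ] IsFLCLabeling p a b G f

{-# OPTIONS --safe #-}
module Submission where

-- Label the vertices in order along the path.  The edge joining the vertices labelled
-- i and i + 1 then has edge sum F i + F (i + 1) = F (i + 2), so it gets label 1 exactly
-- when F (i + 2) is a nonzero square mod p.  As i runs over q π values, i + 2 runs over q
-- full periods of the symbol, and the 0-PL condition says that in one period the nonzero
-- squares are exactly as many as the other terms.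

open import Defs
open import Data.Integer.Base using (ℤ; 0ℤ)
open import Data.Nat.Base using (ℕ; _+_; _*_; _≥_)
open import Data.Product.Base using (_,_)
open import Relation.Binary.PropositionalEquality using (_≢_)
open import Relation.Unary using (_∈_)

open import Algebra.Bundles using (AbelianGroup)
open import Algebra.Properties.Group using (∙-cancelˡ)
open import Algebra.Properties.Monoid.Sum using ()
  renaming (sum to monoidSum; sum-cong-≗ to monoidSum-cong)
open import Data.Bool.Base using (true; false; if_then_else_)
open import Data.Fin.Base as Fin using (Fin; inject₁; toℕ)
open import Data.Fin.Properties as Fin using (toℕ-inject₁; toℕ-injective)
open import Data.Fin.Subset using (∣_∣)
open import Data.Integer.Base as ℤ using (+_; 1ℤ; -1ℤ) renaming (_+_ to _+ℤ_; _-_ to _-ℤ_)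
open import Data.Integer.Divisibility.Signed as ℤ using (∣m∣n⇒∣m+n; ∣m∣n⇒∣m-n)
import Data.Integer.Properties as ℤ
open import Data.Integer.Solver using (module +-*-Solver)
open import Data.List.Base using (allFin; cartesianProduct; filter; length; tabulate)
import Data.List.Membership.Propositional as List
open import Data.List.Membership.Propositional.Properties
  using (∈-allFin; ∈-cartesianProduct⁺; ∈-filter⁺; ∈-filter⁻; ∈-tabulate⁺; ∈-tabulate⁻)
open import Data.List.Membership.Propositional.Properties.WithK using (unique∧set⇒bag)
open import Data.List.Relation.Binary.BagAndSetEquality using (∼bag⇒↭)
open import Data.List.Relation.Binary.Permutation.Propositional using (_↭_)
open import Data.List.Relation.Binary.Permutation.Propositional.Properties
  using (filter-↭; ↭-length)
import Data.List.Relation.Unary.Unique.Propositional.Properties as Unique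
open import Data.Nat.Base as ℕ using (zero; suc; z≤n)
import Data.Nat.Properties as ℕ
open import Data.Product.Base using (_×_; proj₁; proj₂)
open import Data.Sum.Base using (_⊎_; inj₁; inj₂)
import Data.Vec.Base as Vec
open import Function.Base using (_∘_)
open import Function.Bundles using (mk⇔)
open import Function.Construct.Identity using (⤖-id)
open import Relation.Binary.PropositionalEquality
  using (_≡_; _≗_; refl; sym; trans; cong; cong₂; subst; module ≡-Reasoning)
open import Relation.Nullary.Decidable using (Dec; does; does-⇔; _×-dec_)
open import Relation.Nullary.Negation using (contradiction)

open +-*-Solver using (solve; _:+_; _:-_; _:=_; con)

sum : ∀ {n} → (Fin n → ℤ) → ℤ
sum = monoidSum ℤ.+-0-monoid

∑ : ℕ → (ℕ → ℤ) → ℤ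
∑ n f = sum {n} (f ∘ toℕ)

sum-cong : ∀ {n} {f g : Fin n → ℤ} → f ≗ g → sum f ≡ sum g
sum-cong = monoidSum-cong ℤ.+-0-monoid

∑-+ : ∀ m n f → ∑ (m + n) f ≡ ∑ m f +ℤ ∑ n (f ∘ (_+_ m))
∑-+ zero    n f = sym (ℤ.+-identityˡ _)
∑-+ (suc m) n f = trans (cong (f 0 +ℤ_) (∑-+ m n (f ∘ suc))) (sym (ℤ.+-assoc (f 0) _ _))

module _ {f : ℕ → ℤ} {t : ℕ} (f-periodic : ∀ n → f (n + t) ≡ f n) where

  -- Both sums extend to `∑ (suc t) f`, the left by its first term `f 0` and the right by its last
  -- term `f t`. Periodicity equates these two terms, so they cancel.
  ∑-shift : ∑ t (f ∘ suc) ≡ ∑ t f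
  ∑-shift = ∙-cancelˡ (AbelianGroup.group ℤ.+-0-abelianGroup) (f 0) _ _ (begin
    f 0 +ℤ ∑ t (f ∘ suc)           ≡⟨⟩
    ∑ (suc t) f                     ≡⟨ cong (λ n → ∑ n f) (ℕ.+-comm 1 t) ⟩
    ∑ (t + 1) f                     ≡⟨ ∑-+ t 1 f ⟩
    ∑ t f +ℤ (f (t + 0) +ℤ 0ℤ)    ≡⟨ cong (∑ t f +ℤ_) (ℤ.+-identityʳ _) ⟩
    ∑ t f +ℤ f (t + 0)             ≡⟨ cong (λ n → ∑ t f +ℤ f n) (ℕ.+-identityʳ t) ⟩
    ∑ t f +ℤ f t                   ≡⟨ cong (∑ t f +ℤ_) (f-periodic 0) ⟩
    ∑ t f +ℤ f 0                   ≡⟨ ℤ.+-comm (∑ t f) (f 0) ⟩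
    f 0 +ℤ ∑ t f                   ∎)
    where open ≡-Reasoning

  ∑-periods : ∑ t f ≡ 0ℤ → ∀ q → ∑ (q * t) f ≡ 0ℤ
  ∑-periods ∑≡0 zero    = refl
  ∑-periods ∑≡0 (suc q) = begin
    ∑ (t + q * t) f                      ≡⟨ ∑-+ t (q * t) f ⟩
    ∑ t f +ℤ ∑ (q * t) (f ∘ (_+_ t))     ≡⟨ cong₂ _+ℤ_ ∑≡0 (sum-cong shift) ⟩
    0ℤ +ℤ ∑ (q * t) f                   ≡⟨ ℤ.+-identityˡ _ ⟩
    ∑ (q * t) f                          ≡⟨ ∑-periods ∑≡0 q ⟩
    0ℤ                                   ∎
    where
    open ≡-Reasoning
    shift : ∀ (i : Fin (q * t)) → f (t + toℕ i) ≡ f (toℕ i)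
    shift i = trans (cong f (ℕ.+-comm t (toℕ i))) (f-periodic (toℕ i))

-- The residue 0 counts as negative, as in both the k-PL condition and the edge labels.
sign : ℤ → ℤ
sign j = if does (j ℤ.≟ 1ℤ) then 1ℤ else -1ℤ

-- `legendre` uses its two decisions only through `does`, so the claim may be generalised to
-- arbitrary Booleans, where each case computes.
legendre-cases : ∀ p x → legendre p x ≡ 1ℤ ⊎ legendre p x ≡ -1ℤ ⊎ legendre p x ≡ 0ℤ
legendre-cases p x = cases (does (+ OddPrime.value p ℤ.∣? x)) (does (isSquareMod? p x))
  where
  cases : ∀ c d → let j = if c then 0ℤ else if d then 1ℤ else -1ℤ in
          j ≡ 1ℤ ⊎ j ≡ -1ℤ ⊎ j ≡ 0ℤ
  cases true  _     = inj₂ (inj₂ refl)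
  cases false true  = inj₁ refl
  cases false false = inj₂ (inj₁ refl)

-- Divisibility by `p` and being a square mod `p` both respect congruence, with the same square root
-- `z` serving `x` and `y`. Only the Booleans have to agree, hence `does-⇔`.
legendre-cong : ∀ p {x y} → x ≡ y [mod p ] → legendre p x ≡ legendre p y
legendre-cong p {x} {y} x≡y = cong₂ (λ c d → if c then 0ℤ else if d then 1ℤ else -1ℤ)
  (does-⇔ (mk⇔
      (λ p∣x → subst (v ℤ.∣_) (solve 2 (λ x y → x :- (x :- y) := y) refl x y) (∣m∣n⇒∣m-n p∣x x≡y))
      (λ p∣y → subst (v ℤ.∣_) (solve 2 (λ x y → (x :- y) :+ y := x) refl x y) (∣m∣n⇒∣m+n x≡y p∣y)))
    (v ℤ.∣? x) (v ℤ.∣? y))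
  (does-⇔ (mk⇔
      (λ (z , d) → z , subst (v ℤ.∣_)
        (solve 3 (λ z x y → (z :- x) :+ (x :- y) := z :- y) refl (z ℤ.* z) x y) (∣m∣n⇒∣m+n d x≡y))
      (λ (z , d) → z , subst (v ℤ.∣_)
        (solve 3 (λ z x y → (z :- y) :- (x :- y) := z :- x) refl (z ℤ.* z) x y) (∣m∣n⇒∣m-n d x≡y)))
    (isSquareMod? p x) (isSquareMod? p y))
  where v = + OddPrime.value p

-- For the symbols of one period this unfolds to the cardinality of `Λ j p a b`, so the results
-- below apply to the k-PL condition directly.
classSize : ∀ {n} → (Fin n → ℤ) → ℤ → ℤ
classSize g j = + ∣ Vec.tabulate (λ i → does (g i ℤ.≟ j)) ∣

-- Each index belongs to exactly one of the three classes, and `sign` is the coefficient with which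
-- that class enters the left side.
tabulate-sign-sum : ∀ {n} (g : Fin n → ℤ) → (∀ i → g i ≡ 1ℤ ⊎ g i ≡ -1ℤ ⊎ g i ≡ 0ℤ) →
  classSize g 1ℤ -ℤ classSize g -1ℤ -ℤ classSize g 0ℤ ≡ sum (sign ∘ g)
tabulate-sign-sum {zero}  g g-cases = refl
tabulate-sign-sum {suc n} g g-cases = step
  where
  size : ℤ → ℤ
  size = classSize (g ∘ Fin.suc)

  ih : size 1ℤ -ℤ size -1ℤ -ℤ size 0ℤ ≡ sum (sign ∘ g ∘ Fin.suc)
  ih = tabulate-sign-sum (g ∘ Fin.suc) (g-cases ∘ Fin.suc)

  step : classSize g 1ℤ -ℤ classSize g -1ℤ -ℤ classSize g 0ℤ ≡ sum (sign ∘ g)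
  step with g-cases Fin.zero
  -- Once the value of `g Fin.zero` is substituted, all three counts and the leading sign compute;
  -- what remains is rearrangement.
  ... | inj₁ eq        rewrite eq = trans
    (solve 3 (λ x y z → (con 1ℤ :+ x) :- y :- z := con 1ℤ :+ (x :- y :- z)) refl
      (size 1ℤ) (size -1ℤ) (size 0ℤ))
    (cong (1ℤ +ℤ_) ih)
  ... | inj₂ (inj₁ eq) rewrite eq = trans
    (solve 3 (λ x y z → x :- (con 1ℤ :+ y) :- z := con -1ℤ :+ (x :- y :- z)) refl
      (size 1ℤ) (size -1ℤ) (size 0ℤ))
    (cong (-1ℤ +ℤ_) ih)
  ... | inj₂ (inj₂ eq) rewrite eq = trans
    (solve 3 (λ x y z → x :- y :- (con 1ℤ :+ z) := con -1ℤ :+ (x :- y :- z)) refl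
      (size 1ℤ) (size -1ℤ) (size 0ℤ))
    (cong (-1ℤ +ℤ_) ih)

sum-sign-π : ∀ p a b k → IsPLPrime k p a b → ∑ (π p a b) (λ n → sign (legendre p (F a b n))) ≡ k
sum-sign-π p a b k pl = sym (trans pl
  (tabulate-sign-sum {π p a b} (legendre p ∘ F a b ∘ toℕ) (λ i → legendre-cases p (F a b (toℕ i)))))

labelSize : ∀ {A : Set} → (A → ℤ) → ∀ {n} → (Fin n → A) → ℤ → ℤ
labelSize ℓ h j = + length (filter (λ x → ℓ x ℤ.≟ j) (tabulate h))

-- Labels take the values 1 and 0 where signs take 1 and -1, so the two are matched index by index
-- through a hypothesis.
filter-sign-sum : ∀ {A : Set} (ℓ : A → ℤ) {n} (h : Fin n → A) (s : Fin n → ℤ) →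
  (∀ i → ℓ (h i) ≡ 1ℤ × s i ≡ 1ℤ ⊎ ℓ (h i) ≡ 0ℤ × s i ≡ -1ℤ) →
  labelSize ℓ h 1ℤ -ℤ labelSize ℓ h 0ℤ ≡ sum s
filter-sign-sum ℓ {zero}  h s ℓ-cases = refl
filter-sign-sum ℓ {suc n} h s ℓ-cases = step
  where
  size : ℤ → ℤ
  size = labelSize ℓ (h ∘ Fin.suc)

  ih : size 1ℤ -ℤ size 0ℤ ≡ sum (s ∘ Fin.suc)
  ih = filter-sign-sum ℓ (h ∘ Fin.suc) (s ∘ Fin.suc) (ℓ-cases ∘ Fin.suc)

  step : labelSize ℓ h 1ℤ -ℤ labelSize ℓ h 0ℤ ≡ sum s
  step with ℓ-cases Fin.zero
  ... | inj₁ (eq , eq′) rewrite eq | eq′ = trans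
    (solve 2 (λ x y → (con 1ℤ :+ x) :- y := con 1ℤ :+ (x :- y)) refl
      (size 1ℤ) (size 0ℤ))
    (cong (1ℤ +ℤ_) ih)
  ... | inj₂ (eq , eq′) rewrite eq | eq′ = trans
    (solve 2 (λ x y → x :- (con 1ℤ :+ y) := con -1ℤ :+ (x :- y)) refl
      (size 1ℤ) (size 0ℤ))
    (cong (-1ℤ +ℤ_) ih)

pathEdge : ∀ {n} → Fin n → Fin (suc n) × Fin (suc n)
pathEdge i = inject₁ i , Fin.suc i

-- Both lists are free of duplicates and have the same members, which makes them permutations of
-- each other. That suffices for counting, and the order in which the product is filtered never has
-- to be traced.
path-edges : ∀ n → SimpleConnectedGraph.edges (path (suc n)) ↭ tabulate {n = n} pathEdge
path-edges n = ∼bag⇒↭ (unique∧set⇒bag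
  (Unique.filter⁺ edge? (Unique.cartesianProduct⁺ (Unique.allFin⁺ _) (Unique.allFin⁺ _)))
  (Unique.tabulate⁺ (Fin.suc-injective ∘ cong proj₂))
  (mk⇔ to from))
  where
  open SimpleConnectedGraph (path (suc n))

  edge? : ∀ ((u , v) : Fin (suc n) × Fin (suc n)) → Dec (u Fin.< v × u ~ v)
  edge? (u , v) = (u Fin.<? v) ×-dec (u ~? v)

  to : ∀ {e} → e List.∈ edges → e List.∈ tabulate pathEdge
  to {u , v} e∈ with proj₂ (∈-filter⁻ edge? {xs = cartesianProduct (allFin _) (allFin _)} e∈)
  -- An edge is listed with its smaller endpoint first, which excludes this orientation.
  ... | u<v , inj₂ u≡1+v = contradiction u<v (ℕ.<⇒≯ (ℕ.≤-reflexive (sym u≡1+v)))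
  to {u , Fin.suc i} e∈ | u<v , inj₁ v≡1+u
    rewrite toℕ-injective {i = u} {j = inject₁ i}
              (trans (sym (ℕ.suc-injective v≡1+u)) (sym (toℕ-inject₁ i)))
    = ∈-tabulate⁺ i

  from : ∀ {e} → e List.∈ tabulate pathEdge → e List.∈ edges
  from e∈ with ∈-tabulate⁻ e∈
  ... | i , refl = ∈-filter⁺ edge? (∈-cartesianProduct⁺ (∈-allFin _) (∈-allFin _))
    ( ℕ.≤-reflexive (cong suc (toℕ-inject₁ i))
    , inj₁ (cong suc (sym (toℕ-inject₁ i))))

edgeLabel-cases : ∀ {n} p a b (i : Fin n) →
  let ℓ = edgeLabel p a b (⤖-id _) (inject₁ i) (Fin.suc i)
      s = sign (legendre p (F a b (suc (suc (toℕ i))))) in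
  ℓ ≡ 1ℤ × s ≡ 1ℤ ⊎ ℓ ≡ 0ℤ × s ≡ -1ℤ
edgeLabel-cases p a b i
  rewrite toℕ-inject₁ i
        | ℤ.+-comm (F a b (toℕ i)) (F a b (suc (toℕ i)))
        -- The edge label tests whether `p` divides `s - 0ℤ`, while `legendre` tests `s` itself.
        -- Removing the zero makes both tests the same Boolean `c` below.
        | ℤ.+-identityʳ (F a b (suc (toℕ i)) +ℤ F a b (toℕ i))
  = cases (does (+ OddPrime.value p ℤ.∣? x)) (does (isSquareMod? p x))
  where
  x = F a b (suc (suc (toℕ i)))
  cases : ∀ c d → let j = if c then 0ℤ else if d then 1ℤ else -1ℤ
                      ℓ = if c then 0ℤ else (1ℤ +ℤ j) ℤ./ℕ 2 in
          ℓ ≡ 1ℤ × sign j ≡ 1ℤ ⊎ ℓ ≡ 0ℤ × sign j ≡ -1ℤ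
  cases true  _     = inj₂ (refl , refl)
  cases false true  = inj₁ (refl , refl)
  cases false false = inj₂ (refl , refl)

edgeCount-path : ∀ p a b n →
  let count = edgeCount p a b (path (suc n)) (⤖-id _) in
  + count 1ℤ -ℤ + count 0ℤ ≡ ∑ n (λ k → sign (legendre p (F a b (suc (suc k)))))
edgeCount-path p a b n = trans
  (cong₂ (λ x y → + x -ℤ + y) (count≡ 1ℤ) (count≡ 0ℤ))
  (filter-sign-sum label pathEdge _ (edgeLabel-cases p a b))
  where
  label : Fin (suc n) × Fin (suc n) → ℤ
  label (u , v) = edgeLabel p a b (⤖-id _) u v

  count≡ : ∀ j → edgeCount p a b (path (suc n)) (⤖-id _) j ≡
                 length (filter (λ e → label e ℤ.≟ j) (tabulate pathEdge))
  count≡ j = ↭-length (filter-↭ (λ e → label e ℤ.≟ j) (path-edges n))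

theorem3p1 : (a b : ℤ) → (a , b) ≢ (0ℤ , 0ℤ) → 0ℤ ∈ χ a b →
    (p : OddPrime) → IsPLPrime 0ℤ p a b →
    (q : ℕ) → q ≥ 1 → IsFLCGraph p a b (path (q * π p a b + 1))
theorem3p1 a b _ _ p pl q _ =
  -- The path lemmas need the order in the form `suc n`, with `n` the number of edges.
  subst (λ n → IsFLCGraph p a b (path n)) (ℕ.+-comm 1 (q * t))
    (⤖-id _ , ℕ.≤-trans (ℕ.≤-reflexive (ℕ.m≡n⇒∣m-n∣≡0 (sym e₁≡e₀))) z≤n)
  where
  t : ℕ
  t = π p a b

  f : ℕ → ℤ
  f n = sign (legendre p (F a b n))

  f-periodic : ∀ n → f (n + t) ≡ f n
  f-periodic n = cong sign
    (legendre-cong p (IsPisanoPeriod.isPeriod (π-isPisanoPeriod p a b) n))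

  ∑-window : ∑ t (f ∘ suc ∘ suc) ≡ 0ℤ
  ∑-window = begin
    -- Edge sums begin at `F a b 2`, whereas `Λ` counts from index 0; each of the two shifts moves
    -- the window back by one.
    ∑ t (f ∘ suc ∘ suc)  ≡⟨ ∑-shift (f-periodic ∘ suc) ⟩
    ∑ t (f ∘ suc)        ≡⟨ ∑-shift f-periodic ⟩
    ∑ t f                ≡⟨ sum-sign-π p a b 0ℤ pl ⟩
    0ℤ                   ∎
    where open ≡-Reasoning

  count : ℤ → ℕ
  count = edgeCount p a b (path (suc (q * t))) (⤖-id _)

  e₁≡e₀ : count 1ℤ ≡ count 0ℤ
  e₁≡e₀ = ℤ.+-injective (ℤ.i-j≡0⇒i≡j (+ count 1ℤ) (+ count 0ℤ)
    (trans (edgeCount-path p a b (q * t)) (∑-periods (f-periodic ∘ suc ∘ suc) ∑-window q)))
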